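{- If the Havel--Hakimi trajectory of a graphic sequence reaches a unit-band step, then every later step with positive pivot is also a unit-band step.
   Context: A finite sequence of nonnegative integers is graphic if it is the degree sequence of a finite simple graph. A Havel--Hakimi step on a nonincreasing graphic sequence $\mathbf d=(d_1,\ldots,d_t)$ with $d_1=D>0$ deletes $d_1=D$ (the pivot), subtracts one from each of $d_2,\ldots,d_{D+1}$ (the selected entries, positive by graphicality), and reorders in nonincreasing order. Repeating while the largest term is positive gives the trajectory. A step with pivot $D$ is a unit-band step if every selected degree (before subtraction) belongs to $\{D,D-1\}$. -}

module Defs where

open import Data.Fin.Base using (Fin)
open import Data.Fin.Subset using (Subset; _∈_; _∉_; ∣_∣)
open import Data.List.Base using (List; _∷_; _++_; map; take; drop; tabulate)
open import Data.List.Relation.Binary.Pointwise using (Pointwise-≡⇒≡)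
open import Data.List.Relation.Binary.Permutation.Propositional using (↭⇒↭ₛ)
open import Data.List.Relation.Unary.All using (All)
open import Data.Nat.Base using (ℕ; pred; _<_)
open import Data.Nat.Properties using (≤-decTotalOrder)
open import Data.Product.Base using (Σ-syntax)
open import Data.Sum.Base using (_⊎_)
open import Relation.Binary.Bundles using (DecTotalOrder)
open import Relation.Binary.Construct.Closure.ReflexiveTransitive using (Star)
import Relation.Binary.Construct.Flip.EqAndOrd as Flip
open import Relation.Binary.PropositionalEquality.Core using (_≡_)
import Data.List.Sort as Sort
import Data.List.Relation.Unary.Sorted.TotalOrder as Sorted
import Data.List.Relation.Unary.Sorted.TotalOrder.Properties as Sortedₚ

record SimpleGraph (n : ℕ) : Set where
  field
    neighbours : Fin n → Subset n
    symmetric  : ∀ {u v} → v ∈ neighbours u → u ∈ neighbours v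
    loopless   : ∀ {v} → v ∉ neighbours v

  degree : Fin n → ℕ
  degree v = ∣ neighbours v ∣

  degreeSequence : List ℕ
  degreeSequence = tabulate degree

-- Vertices may be relabelled, so no order is imposed on the sequence.
Graphic : List ℕ → Set
Graphic d = Σ[ n ∈ ℕ ] Σ[ G ∈ SimpleGraph n ] SimpleGraph.degreeSequence G ≡ d

≥-decTotalOrder : DecTotalOrder _ _ _
≥-decTotalOrder = Flip.decTotalOrder ≤-decTotalOrder

open DecTotalOrder ≥-decTotalOrder using () renaming (totalOrder to ≥-totalOrder)

Nonincreasing : List ℕ → Set
Nonincreasing = Sorted.Sorted ≥-totalOrder

open Sort ≥-decTotalOrder public
  using () renaming (sort to reorder; sort-↭ to reorder-↭; sort-↗ to reorder-↘)

reorder-nonincreasing : ∀ {d} → Nonincreasing d → reorder d ≡ d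
reorder-nonincreasing {d} d↘ = Pointwise-≡⇒≡
  (Sortedₚ.↗↭↗⇒≋ ≥-totalOrder (reorder-↘ d) d↘ (↭⇒↭ₛ (reorder-↭ d)))

infix 4 _⟶_ _⟶*_

-- The selected entries are take D ds.  On a graphic sequence ds has at least D
-- entries and the selected ones are positive, so neither take nor pred
-- truncates.
data _⟶_ : List ℕ → List ℕ → Set where
  step : ∀ {D ds} → Nonincreasing (D ∷ ds) → 0 < D →
         (D ∷ ds) ⟶ reorder (map pred (take D ds) ++ drop D ds)

UnitBand : ∀ {d e} → d ⟶ e → Set
UnitBand (step {D} {ds} _ _) = All (λ s → s ≡ D ⊎ s ≡ pred D) (take D ds)

-- There is no step from a sequence that is empty or has largest term 0, so
-- the trajectory of d is the set of sequences reachable from reorder d.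
_⟶*_ : List ℕ → List ℕ → Set
_⟶*_ = Star _⟶_

{-# OPTIONS --safe #-}
module Submission where

open import Data.List.Base
  using (List; []; _∷_; _++_; map; take; drop; filter; length)
open import Data.List.Properties using (filter-accept; filter-none; length-map)
open import Data.List.Relation.Binary.Permutation.Propositional using (_↭_; ↭-sym)
open import Data.List.Relation.Binary.Permutation.Propositional.Properties
  using (All-resp-↭; ↭-length; filter-↭)
open import Data.List.Relation.Unary.All as All using (All; []; _∷_)
import Data.List.Relation.Unary.All.Properties as All
open import Data.List.Relation.Unary.AllPairs using (AllPairs; []; _∷_)
open import Data.List.Relation.Unary.Linked.Properties using (Linked⇒AllPairs)
open import Data.Nat.Base
  using (ℕ; zero; suc; pred; _+_; _≤_; _<_; _≥_; z≤n; s≤s; s≤s⁻¹; >-nonZero)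
open import Data.Nat.Properties
open import Data.Product.Base using (Σ-syntax; _×_; _,_)
open import Data.Sum.Base using (_⊎_; inj₁; inj₂)
open import Relation.Binary.Construct.Closure.ReflexiveTransitive using (ε; _◅_)
open import Relation.Binary.PropositionalEquality
open import Relation.Nullary using (yes; no; contradiction)
open import Defs

-- Call a sequence crowded when, for some bound B on its entries, either more
-- than B entries lie in {B, B-1} or all of them do.  Any step from a crowded
-- sequence is a unit-band step: its pivot is at most B, so the pivot and the
-- selected entries are among the largest B + 1 entries.  Conversely a unit-band
-- step with pivot D ends in a crowded sequence.  If D still occurs among the
-- unselected entries, then all D selected entries were D; their reductions to
-- D-1 and a remaining D show that B = D works.  Otherwise B = D-1 works, since
-- the reduced entries lie in {D-1, D-2}.

count≥ : ℕ → List ℕ → ℕ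
count≥ k xs = length (filter (k ≤?_) xs)

count≥-↭ : ∀ k {xs ys} → xs ↭ ys → count≥ k xs ≡ count≥ k ys
count≥-↭ k p = ↭-length (filter-↭ (k ≤?_) p)

count≥-accept : ∀ {k x} xs → k ≤ x → count≥ k (x ∷ xs) ≡ suc (count≥ k xs)
count≥-accept {k} xs k≤x = cong length (filter-accept (k ≤?_) {xs = xs} k≤x)

count≥-++ : ∀ {k us} vs → All (k ≤_) us →
            count≥ k (us ++ vs) ≡ length us + count≥ k vs
count≥-++ vs []           = refl
count≥-++ {us = _ ∷ us} vs (k≤u ∷ k≤us) =
  trans (count≥-accept (us ++ vs) k≤u) (cong suc (count≥-++ vs k≤us))

-- In a nonincreasing list the entries that reach `k` form a prefix: once a head falls below `k`, so
-- does everything after it, and the count is 0.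
take-count≥ : ∀ {k} m {xs} → AllPairs _≥_ xs → m ≤ count≥ k xs →
              All (k ≤_) (take m xs)
take-count≥ zero    _  _ = []
take-count≥ (suc m) [] _ = []
take-count≥ {k} (suc m) {x ∷ xs} (x≥xs ∷ xs↘) m<c with k ≤? x
... | yes k≤x = k≤x ∷ take-count≥ m xs↘
  (s≤s⁻¹ (subst (suc m ≤_) (count≥-accept xs k≤x) m<c))
... | no  k≰x = contradiction (subst (suc m ≤_) (cong length none) m<c) λ ()
  where
  none : filter (k ≤?_) (x ∷ xs) ≡ []
  none = filter-none (k ≤?_) (k≰x ∷ All.map (λ x≥y k≤y → k≰x (≤-trans k≤y x≥y)) x≥xs)

Nonincreasing⇒AllPairs : ∀ {xs} → Nonincreasing xs → AllPairs _≥_ xs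
Nonincreasing⇒AllPairs = Linked⇒AllPairs (λ x≥y y≥z → ≤-trans y≥z x≥y)

-- The largest unselected entry `v` will decide which bound witnesses crowding. If `v` exists,
-- `take` has not run out of entries, so exactly `D` of them get reduced.
drop-cases : ∀ D {ds} → AllPairs _≥_ ds →
  drop D ds ≡ [] ⊎
  Σ[ v ∈ ℕ ] Σ[ vs ∈ List ℕ ] drop D ds ≡ v ∷ vs × All (_≤ v) vs ×
    length (take D ds) ≡ D × All (v ≤_) (take D ds)
drop-cases zero    [] = inj₁ refl
drop-cases zero    (d≥ds ∷ _) = inj₂ (_ , _ , refl , d≥ds , refl , [])
drop-cases (suc D) [] = inj₁ refl
drop-cases (suc D) {d ∷ ds} (d≥ds ∷ ds↘) with drop-cases D ds↘
... | inj₁ eq = inj₁ eq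
... | inj₂ (v , vs , eq , v≥vs , len , v≤us) =
  inj₂ (v , vs , eq , v≥vs , cong suc len ,
        -- `v` comes from `ds`, so it is at most `d`.
        All.head (subst (All (_≤ d)) eq (All.drop⁺ D d≥ds)) ∷ v≤us)

-- Since `B` bounds all entries, lying in {B, B-1} amounts to reaching `pred B`, which a one-sided
-- count detects.
Crowded : List ℕ → Set
Crowded xs = Σ[ B ∈ ℕ ] All (_≤ B) xs × (All (pred B ≤_) xs ⊎ B < count≥ (pred B) xs)

crowded-↭ : ∀ {xs ys} → xs ↭ ys → Crowded xs → Crowded ys
crowded-↭ p (B , ≤B , inj₁ all) = B , All-resp-↭ p ≤B , inj₁ (All-resp-↭ p all)
crowded-↭ p (B , ≤B , inj₂ B<c) =
  B , All-resp-↭ p ≤B , inj₂ (subst (B <_) (count≥-↭ (pred B) p) B<c)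

in-band : ∀ {x D} → x ≤ D → pred D ≤ x → x ≡ D ⊎ x ≡ pred D
in-band {D = zero}  x≤D _ = inj₁ (n≤0⇒n≡0 x≤D)
in-band {D = suc D} x≤D D≤x with m≤n⇒m<n∨m≡n x≤D
... | inj₁ x<D = inj₂ (≤-antisym (s≤s⁻¹ x<D) D≤x)
... | inj₂ x≡D = inj₁ x≡D

crowded⇒unitBand : ∀ {d e} → Crowded d → (t : d ⟶ e) → UnitBand t
crowded⇒unitBand (B , D≤B ∷ _ , crowd) (step {D} {ds} ↘ _)
  with D≥ds ∷ ds↘ ← Nonincreasing⇒AllPairs ↘ =
  All.zipWith (λ (x≤D , x≥) → in-band x≤D (≤-trans (pred-mono-≤ D≤B) x≥))
    (All.take⁺ D D≥ds , large crowd)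
  where
  large : All (pred B ≤_) (D ∷ ds) ⊎ B < count≥ (pred B) (D ∷ ds) →
          All (pred B ≤_) (take D ds)
  large (inj₁ (_ ∷ all)) = All.take⁺ D all
  -- The pivot is counted too, so the prefix has length D + 1 ≤ B + 1; the tail leaves the selected
  -- entries.
  large (inj₂ B<c) = All.tail
    (take-count≥ (suc D) (Nonincreasing⇒AllPairs ↘) (≤-trans (s≤s D≤B) B<c))

-- Crowding is invariant under permutation, so it can be checked before reordering.
reduced-crowded : ∀ {D ds} → 0 < D → AllPairs _≥_ ds → All (_≤ D) ds →
  All (pred D ≤_) (take D ds) → Crowded (map pred (take D ds) ++ drop D ds)
reduced-crowded {D} {ds} 0<D ds↘ ds≤D band = cases (drop-cases D ds↘)
  where
  us = map pred (take D ds)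

  map-pred-≥ : ∀ {k} → All (k ≤_) (take D ds) → All (pred k ≤_) us
  map-pred-≥ k≤ = All.map⁺ (All.map pred-mono-≤ k≤)

  us≤ : All (_≤ pred D) us
  us≤ = All.map⁺ (All.map pred-mono-≤ (All.take⁺ D ds≤D))

  cases : drop D ds ≡ [] ⊎
    Σ[ v ∈ ℕ ] Σ[ vs ∈ List ℕ ] drop D ds ≡ v ∷ vs × All (_≤ v) vs ×
      length (take D ds) ≡ D × All (v ≤_) (take D ds) →
    Crowded (us ++ drop D ds)
  -- Only reduced entries remain, possibly fewer than `D`, hence the "all of them" alternative.
  cases (inj₁ eq) rewrite eq =
    pred D , All.++⁺ us≤ [] , inj₁ (All.++⁺ (map-pred-≥ band) [])
  cases (inj₂ (v , vs , eq , vs≤v , len , v≤))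
    with v≤D ∷ vs≤D ← subst (All (_≤ D)) eq (All.drop⁺ D ds≤D)
    rewrite eq with m≤n⇒m<n∨m≡n v≤D
  -- The `D` reduced entries alone exceed the bound D - 1, because `D` is positive.
  ... | inj₁ v<D =
    pred D
    , All.++⁺ us≤ (v≤pD ∷ All.map (λ x≤v → ≤-trans x≤v v≤pD) vs≤v)
    , inj₂ (begin-strict
        pred D                                  <⟨ ≤-reflexive (suc-pred D) ⟩
        D                                       ≡⟨ |us| ⟨
        length us                               ≤⟨ m≤m+n _ _ ⟩
        length us + count≥ (pred (pred D)) (v ∷ vs)
          ≡⟨ count≥-++ (v ∷ vs) (map-pred-≥ band) ⟨
        count≥ (pred (pred D)) (us ++ v ∷ vs) ∎)
    where
    open ≤-Reasoning
    instance _ = >-nonZero 0<D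
    |us| = trans (length-map pred (take D ds)) len
    v≤pD = <⇒≤pred v<D
  -- Now `v≤` says that the selected entries reach `D`, sharper than `band`; the `D` reductions and
  -- the leftover `D` make at least D + 1.
  ... | inj₂ refl =
    D
    , All.++⁺ (All.map (λ x≤ → ≤-trans x≤ pred[n]≤n) us≤) (v≤D ∷ vs≤D)
    , inj₂ (begin-strict
        D                                         ≡⟨ |us| ⟨
        length us                                 <⟨ m<m+n _ (s≤s z≤n) ⟩
        length us + suc (count≥ (pred D) vs)
          ≡⟨ cong (length us +_) (count≥-accept vs pred[n]≤n) ⟨
        length us + count≥ (pred D) (D ∷ vs)
          ≡⟨ count≥-++ (D ∷ vs) (map-pred-≥ v≤) ⟨
        count≥ (pred D) (us ++ D ∷ vs)            ∎)
    where
    open ≤-Reasoning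
    |us| = trans (length-map pred (take D ds)) len

unitBand⇒crowded : ∀ {d e} (s : d ⟶ e) → UnitBand s → Crowded e
unitBand⇒crowded (step {D} {ds} ↘ 0<D) band
  with D≥ds ∷ ds↘ ← Nonincreasing⇒AllPairs ↘ =
  crowded-↭ (↭-sym (reorder-↭ _))
    (reduced-crowded 0<D ds↘ D≥ds (All.map pred≤ band))
  where
  pred≤ : ∀ {x} → x ≡ D ⊎ x ≡ pred D → pred D ≤ x
  pred≤ (inj₁ refl) = pred[n]≤n
  pred≤ (inj₂ refl) = ≤-refl

crowded-⟶* : ∀ {d e} → Crowded d → d ⟶* e → Crowded e
crowded-⟶* c ε        = c
crowded-⟶* c (s ◅ ss) =
  crowded-⟶* (unitBand⇒crowded s (crowded⇒unitBand c s)) ss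

lemma10 : ∀ (d : List ℕ) → Graphic d →
    ∀ {a b} → reorder d ⟶* a → (s : a ⟶ b) → UnitBand s →
    ∀ {e f} → b ⟶* e → (t : e ⟶ f) → UnitBand t
lemma10 _ _ _ s band b⟶*e t =
  crowded⇒unitBand (crowded-⟶* (unitBand⇒crowded s band) b⟶*e) t
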